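{- Let $\alpha$, $\delta$, $\psi$, $\omega$ denote the Niemeier lattices with root systems $D_{24}$, $A_{24}$, $A_1^{24}$, and the Leech lattice (no roots), respectively. Let $S_1=\begin{pmatrix}4&1\\1&6\end{pmatrix}$ and $S_2=\begin{pmatrix}2&1\\1&12\end{pmatrix}$. Then \[ \vartheta_\alpha^{(3)}\equiv\vartheta_\omega^{(3)}\equiv\vartheta_{S_1}^{(3)}\pmod{23},\qquad \vartheta_\delta^{(3)}\equiv\vartheta_\psi^{(3)}\equiv\vartheta_{S_2}^{(3)}\pmod{23}, \] where congruence mod 23 means that all Fourier coefficients $a(\cdot\,;T)$, $T\ge0$ in $\mathrm{Sym}_3^*(\mathbb{Z})$, are congruent modulo 23.
   Context: For a positive definite even symmetric matrix $S\in\mathrm{Sym}_m(\mathbb{Z})$ (Gram matrix of a lattice), $\vartheta_S^{(n)}(Z)=\sum_{X\in M_{m,n}(\mathbb{Z})}\exp(\pi\sqrt{ -1}\,\mathrm{tr}({}^tXSX\,Z))=\sum_{T}a(\vartheta_S^{(n)};T)\exp(2\pi\sqrt{ -1}\mathrm{tr}(TZ))$, $Z$ in the Siegel upper half-space of degree $n$, $T$ running over positive semidefinite elements of $\mathrm{Sym}_n^*(\mathbb{Z})=\{T\in\mathrm{Sym}_n(\mathbb{Q}):t_{ii},2t_{ij}\in\mathbb{Z}\}$; for a lattice $\mathcal{L}$ with Gram matrix $S$, $\vartheta_{\mathcal{L}}^{(n)}=\vartheta_S^{(n)}$. A Niemeier lattice is a positive definite even unimodular lattice of rank 24 (classified by its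 root system). -}

module Defs where

open import Data.Nat as ℕ using (ℕ)
open import Data.Integer using (ℤ; +_; _-_; _*_; _+_; _≤_)
open import Data.Integer.Divisibility using (_∣_)
open import Data.Bool using (Bool; true; false; _xor_; if_then_else_)
open import Data.Vec using (Vec; []; _∷_; lookup; zipWith; replicate)
open import Data.Vec.Relation.Unary.All using (All)
open import Data.Fin using (Fin; zero; suc)
open import Data.List using (List; length)
open import Data.List.Relation.Unary.Unique.Propositional using (Unique)
open import Data.List.Membership.Propositional using (_∈_)
open import Data.Product using (Σ; ∃; _×_; _,_)
open import Data.Unit using (⊤)
open import Relation.Binary.PropositionalEquality using (_≡_)
open import Function.Bundles using (_⇔_)

infix 4 _≡[_]_
_≡[_]_ : ℤ → ℕ → ℤ → Set
a ≡[ n ] b = (+ n) ∣ (a - b)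

dot : ∀ {d} → Vec ℤ d → Vec ℤ d → ℤ
dot [] [] = + 0
dot (x ∷ xs) (y ∷ ys) = x * y + dot xs ys

vsum : ∀ {d} → Vec ℤ d → ℤ
vsum [] = + 0
vsum (x ∷ xs) = x + vsum xs

b2z : Bool → ℤ
b2z b = if b then + 1 else + 0

-- Lattices, presented as a subgroup L ⊆ ℤ^dim (given by a membership
-- predicate) together with an integral bilinear form `form`; the actual
-- inner product of the lattice is  form x y / scale .

record Lattice : Set₁ where
  field
    dim    : ℕ
    member : Vec ℤ dim → Set
    form   : Vec ℤ dim → Vec ℤ dim → ℤ
    scale  : ℕ

open Lattice public

-- Fourier coefficients of degree-3 theta series.
-- An element T of Sym₃*(ℤ) is encoded by N = 2T : Fin 3 → Fin 3 → ℤ,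
-- i.e. N symmetric integral with even diagonal.

HalfIntegral3 : (Fin 3 → Fin 3 → ℤ) → Set
HalfIntegral3 N = (∀ i j → N i j ≡ N j i) × (∀ i → (+ 2) ∣ N i i)

sum3 : (Fin 3 → ℤ) → ℤ
sum3 f = f zero + (f (suc zero) + f (suc (suc zero)))

-- T ≥ 0 (positive semidefinite): ᵗx (2T) x ≥ 0 for all x (integral x
-- suffices, by scaling and density)
PosSemidef3 : (Fin 3 → Fin 3 → ℤ) → Set
PosSemidef3 N = ∀ (x : Fin 3 → ℤ) → + 0 ≤ sum3 (λ i → sum3 (λ j → x i * (N i j * x j)))

Rep : (L : Lattice) → (Fin 3 → Fin 3 → ℤ) → Vec (Vec ℤ (dim L)) 3 → Set
Rep L N X = All (member L) X
          × (∀ i j → form L (lookup X i) (lookup X j) ≡ (+ scale L) * N i j)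

IsCount : {A : Set} → (A → Set) → ℕ → Set
IsCount {A} P r = Σ (List A) λ xs → Unique xs × length xs ≡ r × (∀ x → (x ∈ xs) ⇔ P x)

ThetaCong3 : Lattice → Lattice → ℕ → Set
ThetaCong3 L L' p =
  ∀ (N : Fin 3 → Fin 3 → ℤ) → HalfIntegral3 N → PosSemidef3 N →
  ∀ (r r' : ℕ) → IsCount (Rep L N) r → IsCount (Rep L' N) r' →
  (+ r) ≡[ p ] (+ r')

-- The extended binary Golay code (cyclic code of length 23 generated by
-- 1+x²+x⁴+x⁵+x⁶+x¹⁰+x¹¹, extended by a parity bit).

golayGen : Vec (Vec Bool 24) 12
golayGen =
    (true ∷ false ∷ true ∷ false ∷ true ∷ true ∷ true ∷ false ∷ false ∷ false ∷ true ∷ true ∷ false ∷ false ∷ false ∷ false ∷ false ∷ false ∷ false ∷ false ∷ false ∷ false ∷ false ∷ true ∷ [])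
  ∷ (false ∷ true ∷ false ∷ true ∷ false ∷ true ∷ true ∷ true ∷ false ∷ false ∷ false ∷ true ∷ true ∷ false ∷ false ∷ false ∷ false ∷ false ∷ false ∷ false ∷ false ∷ false ∷ false ∷ true ∷ [])
  ∷ (false ∷ false ∷ true ∷ false ∷ true ∷ false ∷ true ∷ true ∷ true ∷ false ∷ false ∷ false ∷ true ∷ true ∷ false ∷ false ∷ false ∷ false ∷ false ∷ false ∷ false ∷ false ∷ false ∷ true ∷ [])
  ∷ (false ∷ false ∷ false ∷ true ∷ false ∷ true ∷ false ∷ true ∷ true ∷ true ∷ false ∷ false ∷ false ∷ true ∷ true ∷ false ∷ false ∷ false ∷ false ∷ false ∷ false ∷ false ∷ false ∷ true ∷ [])
  ∷ (false ∷ false ∷ false ∷ false ∷ true ∷ false ∷ true ∷ false ∷ true ∷ true ∷ true ∷ false ∷ false ∷ false ∷ true ∷ true ∷ false ∷ false ∷ false ∷ false ∷ false ∷ false ∷ false ∷ true ∷ [])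
  ∷ (false ∷ false ∷ false ∷ false ∷ false ∷ true ∷ false ∷ true ∷ false ∷ true ∷ true ∷ true ∷ false ∷ false ∷ false ∷ true ∷ true ∷ false ∷ false ∷ false ∷ false ∷ false ∷ false ∷ true ∷ [])
  ∷ (false ∷ false ∷ false ∷ false ∷ false ∷ false ∷ true ∷ false ∷ true ∷ false ∷ true ∷ true ∷ true ∷ false ∷ false ∷ false ∷ true ∷ true ∷ false ∷ false ∷ false ∷ false ∷ false ∷ true ∷ [])
  ∷ (false ∷ false ∷ false ∷ false ∷ false ∷ false ∷ false ∷ true ∷ false ∷ true ∷ false ∷ true ∷ true ∷ true ∷ false ∷ false ∷ false ∷ true ∷ true ∷ false ∷ false ∷ false ∷ false ∷ true ∷ [])
  ∷ (false ∷ false ∷ false ∷ false ∷ false ∷ false ∷ false ∷ false ∷ true ∷ false ∷ true ∷ false ∷ true ∷ true ∷ true ∷ false ∷ false ∷ false ∷ true ∷ true ∷ false ∷ false ∷ false ∷ true ∷ [])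
  ∷ (false ∷ false ∷ false ∷ false ∷ false ∷ false ∷ false ∷ false ∷ false ∷ true ∷ false ∷ true ∷ false ∷ true ∷ true ∷ true ∷ false ∷ false ∷ false ∷ true ∷ true ∷ false ∷ false ∷ true ∷ [])
  ∷ (false ∷ false ∷ false ∷ false ∷ false ∷ false ∷ false ∷ false ∷ false ∷ false ∷ true ∷ false ∷ true ∷ false ∷ true ∷ true ∷ true ∷ false ∷ false ∷ false ∷ true ∷ true ∷ false ∷ true ∷ [])
  ∷ (false ∷ false ∷ false ∷ false ∷ false ∷ false ∷ false ∷ false ∷ false ∷ false ∷ false ∷ true ∷ false ∷ true ∷ false ∷ true ∷ true ∷ true ∷ false ∷ false ∷ false ∷ true ∷ true ∷ true ∷ [])
  ∷ []

golayWord : ∀ {k} → Vec Bool k → Vec (Vec Bool 24) k → Vec Bool 24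
golayWord [] [] = replicate 24 false
golayWord (a ∷ as) (r ∷ rs) = zipWith _xor_ (if a then r else replicate 24 false) (golayWord as rs)

IsGolay : Vec Bool 24 → Set
IsGolay c = ∃ λ (a : Vec Bool 12) → golayWord a golayGen ≡ c

-- α : root system D₂₄.  D₂₄⁺ = D₂₄ ∪ (D₂₄ + (½,…,½)), coordinates scaled by 2:
-- x ∈ ℤ²⁴ with all coordinates of equal parity and Σ xᵢ ≡ 0 mod 4; ⟨x,y⟩ = x·y/4.
latticeD24 : Lattice
latticeD24 = record
  { dim = 24
  ; member = λ x → (∃ λ (m : Bool) → All (λ xi → xi ≡[ 2 ] b2z m) x) × (vsum x ≡[ 4 ] + 0)
  ; form = dot
  ; scale = 4 }

-- δ : root system A₂₄.  A₂₄ ⊂ ℤ²⁵ glued with 5·[1] ∈ A₂₄*/A₂₄, scaled by 5: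
-- x ∈ ℤ²⁵ with Σ xᵢ = 0 and all xᵢ congruent mod 5; ⟨x,y⟩ = x·y/25.
latticeA24 : Lattice
latticeA24 = record
  { dim = 25
  ; member = λ x → (vsum x ≡ + 0) × (∃ λ (k : ℤ) → All (λ xi → xi ≡[ 5 ] k) x)
  ; form = dot
  ; scale = 25 }

latticeA1^24 : Lattice
latticeA1^24 = record
  { dim = 24
  ; member = λ x → ∃ λ (c : Vec Bool 24) → IsGolay c × (∀ i → lookup x i ≡[ 2 ] b2z (lookup c i))
  ; form = dot
  ; scale = 2 }

-- ω : the Leech lattice (Conway's construction):
-- x ∈ ℤ²⁴ with x ≡ m·𝟙 + 2c mod 4 for some m ∈ {0,1}, c in the Golay code,
-- and Σ xᵢ ≡ 4m mod 8; ⟨x,y⟩ = x·y/8.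
latticeLeech : Lattice
latticeLeech = record
  { dim = 24
  ; member = λ x → ∃ λ (m : Bool) → ∃ λ (c : Vec Bool 24) → IsGolay c
               × (∀ i → lookup x i ≡[ 4 ] (b2z m + (+ 2) * b2z (lookup c i)))
               × (vsum x ≡[ 8 ] ((+ 4) * b2z m))
  ; form = dot
  ; scale = 8 }

gram2 : ℤ → ℤ → ℤ → Vec ℤ 2 → Vec ℤ 2 → ℤ
gram2 a b c (x₁ ∷ x₂ ∷ []) (y₁ ∷ y₂ ∷ []) =
  x₁ * (a * y₁ + b * y₂) + x₂ * (b * y₁ + c * y₂)

latticeS1 : Lattice
latticeS1 = record { dim = 2 ; member = λ _ → ⊤ ; form = gram2 (+ 4) (+ 1) (+ 6) ; scale = 1 }

latticeS2 : Lattice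
latticeS2 = record { dim = 2 ; member = λ _ → ⊤ ; form = gram2 (+ 2) (+ 1) (+ 12) ; scale = 1 }

{-# OPTIONS --safe #-}
module Submission where

-- Rotating 23 of the coordinates is an isometry of order 23 of each Niemeier
-- lattice (for ψ and ω because the Golay code is an extended cyclic code).  It
-- permutes the representations of T by the lattice, and as 23 is prime, only the
-- representations fixed by it count modulo 23.  These are the representations of T
-- by the fixed sublattice, which has rank 2 and Gram matrix S₁ for α, ω and S₂ for δ, ψ.

open import Defs
open import Algebra.Bundles using (module CommutativeRing)
import Algebra.Properties.CommutativeSemigroup as CommutativeSemigroup
open import Data.Bool using (Bool; true; false; _xor_; if_then_else_)
import Data.Bool.Properties as Bool
open import Data.Fin using (Fin; zero; suc; fromℕ; inject₁; _↑ˡ_)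
import Data.Fin.Properties as Fin
open import Data.Integer as ℤ using (ℤ; +_; _+_; _-_; -_; _*_)
import Data.Integer.DivMod as ℤ
open import Data.Integer.Divisibility.Signed using (_∣_; divides; ∣ᵤ⇒∣; ∣⇒∣ᵤ; ∣m∣n⇒∣m-n)
import Data.Integer.Properties as ℤ
open import Data.Integer.Tactic.RingSolver using (solve-∀)
open import Data.List as List using (List; []; _∷_; length; filter; applyUpTo)
open import Data.List.Membership.Propositional using (_∈_; _∉_)
import Data.List.Membership.DecPropositional as DecMembership
open import Data.List.Membership.Propositional.Properties
  using (∈-filter⁺; ∈-filter⁻; ∈-map⁺; ∈-map⁻; ∈-applyUpTo⁺; ∈-applyUpTo⁻)
open import Data.List.Membership.Propositional.Properties.WithK using (unique∧set⇒bag)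
open import Data.List.Properties using (length-map; length-applyUpTo; filter-notAll)
open import Data.List.Relation.Binary.BagAndSetEquality using (∼bag⇒↭)
open import Data.List.Relation.Binary.Permutation.Propositional.Properties using (↭-length)
open import Data.List.Relation.Unary.All as ListAll using ([]; _∷_)
open import Data.List.Relation.Unary.Any using (here)
open import Data.List.Relation.Unary.Unique.Propositional using (Unique)
import Data.List.Relation.Unary.Unique.Propositional.Properties as Unique
open import Data.Nat as ℕ using (ℕ; zero; suc; s≤s)
open import Data.Nat.Coprimality using (Coprime; coprime-Bézout; prime⇒coprime)
import Data.Nat.Divisibility as ℕ
open import Data.Nat.GCD using (module Bézout)
open import Data.Nat.GeneralisedArithmetic using (fold; fold-+)
open import Data.Nat.Induction using (<-wellFounded)
open import Data.Nat.Primality using (Prime; prime?)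
import Data.Nat.Properties as ℕ
open import Data.Product using (∃; ∃₂; _×_; _,_; proj₁; proj₂)
open import Data.Unit using (⊤; tt)
open import Data.Vec as Vec using (Vec; []; _∷_; _++_; insertAt; lookup; replicate; zipWith; tabulate)
import Data.Vec.Properties as Vec
open import Data.Vec.Relation.Unary.All as All using (All; []; _∷_)
import Data.Vec.Relation.Unary.All.Properties as All
open import Function using (_∘_; case_of_)
open import Function.Bundles using (_⇔_; mk⇔; module Equivalence)
open import Induction.WellFounded using (Acc; acc)
open import Relation.Binary.Definitions using (DecidableEquality)
open import Relation.Binary.PropositionalEquality
open import Relation.Nullary using (¬_; Dec; does; yes; no; ¬?; contradiction)
open import Relation.Nullary.Decidable using (from-yes; from-no)
open import Relation.Unary using (Decidable)

open Equivalence using (to; from)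

private
  variable
    A B C : Set
    P Q : A → Set
    R : A → B → Set
    d k n r s : ℕ

-- Counting by duplicate-free lists.

unique-length : {xs ys : List A} → Unique xs → Unique ys →
                (∀ {x} → x ∈ xs ⇔ x ∈ ys) → length xs ≡ length ys
unique-length xs! ys! eq = ↭-length (∼bag⇒↭ (unique∧set⇒bag xs! ys! eq))

length-filter-¬ : (P? : Decidable P) (xs : List A) →
                  length xs ≡ length (filter P? xs) ℕ.+ length (filter (¬? ∘ P?) xs)
length-filter-¬ P? [] = refl
length-filter-¬ P? (x ∷ xs) with P? x
... | yes _ = cong suc (length-filter-¬ P? xs)
... | no  _ = trans (cong suc (length-filter-¬ P? xs)) (sym (ℕ.+-suc _ _))

-- Lets a count constructed in the proof be identified with one given as a hypothesis.
IsCount-unique : IsCount P r → IsCount P s → r ≡ s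
IsCount-unique (xs , xs! , refl , xs⇔) (ys , ys! , refl , ys⇔) =
  unique-length xs! ys! (mk⇔ (from (ys⇔ _) ∘ to (xs⇔ _)) (from (xs⇔ _) ∘ to (ys⇔ _)))

IsCount-filter : (Q? : Decidable Q) → ((xs , _) : IsCount P r) →
                 IsCount (λ x → P x × Q x) (length (filter Q? xs))
IsCount-filter Q? (xs , xs! , _ , xs⇔) =
  filter Q? xs , Unique.filter⁺ Q? xs! , refl , λ x → mk⇔
    (λ x∈ → let x∈xs , qx = ∈-filter⁻ Q? x∈ in to (xs⇔ x) x∈xs , qx)
    (λ (px , qx) → ∈-filter⁺ Q? (from (xs⇔ x) px) qx)

preimages : (f : B → A) {xs : List A} → ListAll.All (λ x → ∃ λ y → f y ≡ x) xs →
            ∃ λ ys → List.map f ys ≡ xs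
preimages f [] = [] , refl
preimages f ((y , refl) ∷ pre) with preimages f pre
... | ys , refl = y ∷ ys , refl

-- Meant for the embedding of plane tuples. The list is lifted entry by entry through `f`, and
-- injectivity makes membership in the lift agree with membership in its image.
IsCount-preimage : (f : B → A) → (∀ {x y} → f x ≡ f y → x ≡ y) →
                   (∀ y → P (f y) ⇔ Q y) → (∀ x → P x → ∃ λ y → f y ≡ x) →
                   IsCount P r → IsCount Q r
IsCount-preimage f inj P⇔Q surj (xs , xs! , len , xs⇔)
  with preimages f (ListAll.tabulate λ {x} x∈ → surj x (to (xs⇔ x) x∈))
... | ys , refl =
  ys , Unique.map⁻ xs! , trans (sym (length-map f ys)) len , λ y → mk⇔
    (λ y∈ → to (P⇔Q y) (to (xs⇔ (f y)) (∈-map⁺ f y∈)))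
    (λ qy → let y′ , y′∈ , eq = ∈-map⁻ f (from (xs⇔ (f y)) (from (P⇔Q y) qy))
            in subst (_∈ ys) (sym (inj eq)) y′∈)

-- Orbits of a map of prime order.

module PrimeOrder {A : Set} (_≟_ : DecidableEquality A) (σ : A → A) (q : ℕ)
                  (p-prime : Prime (suc q)) (σ-order : ∀ x → fold x σ (suc q) ≡ x) where

  open DecMembership _≟_ using (_∈?_)

  p : ℕ
  p = suc q

  -- As `suc q` applications of `σ` give the identity, `q` further applications undo one.
  σ-injective : ∀ {x y} → σ x ≡ σ y → x ≡ y
  σ-injective {x} {y} eq = begin
    x                   ≡⟨ unroll x ⟩
    fold (σ x) σ q      ≡⟨ cong (λ z → fold z σ q) eq ⟩
    fold (σ y) σ q      ≡⟨ unroll y ⟨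
    y                   ∎
    where
    open ≡-Reasoning
    unroll : ∀ z → z ≡ fold (σ z) σ q
    unroll z = trans (sym (σ-order z))
                 (trans (cong (fold z σ) (ℕ.+-comm 1 q)) (fold-+ z σ q))

  period-* : ∀ {x n} k → fold x σ n ≡ x → fold x σ (k ℕ.* n) ≡ x
  period-* zero eq = refl
  period-* {x} {n} (suc k) eq =
    trans (fold-+ x σ n) (trans (cong (λ z → fold z σ n) (period-* {x} {n} k eq)) eq)

  -- By Bézout a multiple of one period exceeds a multiple of the other by 1. Both iterates fix `x`,
  -- hence so does the one application of `σ` by which they differ.
  coprime-periods : ∀ {x m n} → Coprime m n → fold x σ m ≡ x → fold x σ n ≡ x → σ x ≡ x
  coprime-periods {x} {m} {n} c pm pn with coprime-Bézout c
  ... | Bézout.+- a b eq = begin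
    σ x                      ≡⟨ cong σ (period-* {x} {n} b pn) ⟨
    fold x σ (1 ℕ.+ b ℕ.* n) ≡⟨ cong (fold x σ) eq ⟩
    fold x σ (a ℕ.* m)       ≡⟨ period-* {x} {m} a pm ⟩
    x                        ∎
    where open ≡-Reasoning
  ... | Bézout.-+ a b eq = begin
    σ x                      ≡⟨ cong σ (period-* {x} {m} a pm) ⟨
    fold x σ (1 ℕ.+ a ℕ.* m) ≡⟨ cong (fold x σ) eq ⟩
    fold x σ (b ℕ.* n)       ≡⟨ period-* {x} {n} b pn ⟩
    x                        ∎
    where open ≡-Reasoning

  orbit : A → List A
  orbit x = applyUpTo (fold x σ) p

  fold-cancel : ∀ {x d} i → fold x σ i ≡ fold x σ (i ℕ.+ d) → fold x σ d ≡ x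
  fold-cancel zero    eq = sym eq
  fold-cancel (suc i) eq = fold-cancel i (σ-injective eq)

  -- If the iterates i < j < p agreed, injectivity would make j - i a period of `x`. Being positive
  -- and less than the prime p, it is coprime to the period p, so `x` would be fixed.
  orbit-unique : ∀ {x} → σ x ≢ x → Unique (orbit x)
  orbit-unique {x} σx≢x = Unique.applyUpTo⁺₁ (fold x σ) p distinct
    where
    distinct : ∀ {i j} → i ℕ.< j → j ℕ.< p → fold x σ i ≢ fold x σ j
    distinct {i} {j} i<j j<p eq = σx≢x (coprime-periods {m = p} {gap}
        (prime⇒coprime p-prime {{ℕ.>-nonZero (ℕ.m<n⇒0<n∸m i<j)}} (ℕ.≤-<-trans (ℕ.m∸n≤m j i) j<p))
        (σ-order x)
        (fold-cancel i (trans eq (cong (fold x σ) (sym (ℕ.m+[n∸m]≡n (ℕ.<⇒≤ i<j)))))))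
      where gap = j ℕ.∸ i

  -- Used in contrapositive form: `σ` does not lead into an orbit from outside. If `σ y` is `x`
  -- itself, then `y` is the last iterate, one application before the return to `x`.
  orbit-pred : ∀ {x y} → σ y ∈ orbit x → y ∈ orbit x
  orbit-pred {x} σy∈ with ∈-applyUpTo⁻ (fold x σ) σy∈
  ... | zero  , _   , eq = subst (_∈ orbit x) (σ-injective (trans (σ-order x) (sym eq)))
                             (∈-applyUpTo⁺ (fold x σ) (ℕ.n<1+n q))
  ... | suc i , i<p , eq = subst (_∈ orbit x) (σ-injective (sym eq))
                             (∈-applyUpTo⁺ (fold x σ) (ℕ.<-trans (ℕ.n<1+n i) i<p))

  Closed : List A → Set
  Closed xs = ∀ {x} → x ∈ xs → σ x ∈ xs

  orbit⊆ : ∀ {xs x} → Closed xs → x ∈ xs → ∀ {y} → y ∈ orbit x → y ∈ xs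
  orbit⊆ {xs} {x} closed x∈ y∈ with ∈-applyUpTo⁻ (fold x σ) y∈
  ... | i , _ , refl = iterates i
    where
    iterates : ∀ i → fold x σ i ∈ xs
    iterates zero    = x∈
    iterates (suc i) = closed (iterates i)

  -- Strong induction on the length: the orbit of the first entry accounts for exactly p entries,
  -- and what remains is again closed and free of fixed points.
  free⇒p∣length : ∀ {xs} → Unique xs → Closed xs → (∀ {x} → x ∈ xs → σ x ≢ x) →
                  p ℕ.∣ length xs
  free⇒p∣length {xs} = go xs (<-wellFounded _)
    where
    go : ∀ xs → Acc ℕ._<_ (length xs) → Unique xs → Closed xs →
         (∀ {x} → x ∈ xs → σ x ≢ x) → p ℕ.∣ length xs
    go [] _ _ _ _ = p ℕ.∣0
    go xs@(x ∷ _) (acc rec) xs! closed free =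
      subst (p ℕ.∣_) (sym (length-filter-¬ (_∈? orbit x) xs))
        (ℕ.∣m∣n⇒∣m+n (ℕ.∣-reflexive (sym orbit-length))
          (go rest (rec rest<xs) (Unique.filter⁺ ∉orbit? xs!) rest-closed
            (free ∘ proj₁ ∘ ∈-filter⁻ ∉orbit? {xs = xs})))
      where
      ∉orbit? : Decidable (_∉ orbit x)
      ∉orbit? = ¬? ∘ (_∈? orbit x)
      rest = filter ∉orbit? xs
      rest<xs : length rest ℕ.< length xs
      -- The first entry is the zeroth iterate in its own orbit, so the filter drops it.
      rest<xs = filter-notAll ∉orbit? xs (here λ x∉ → x∉ (here refl))
      orbit-length : length (filter (_∈? orbit x) xs) ≡ p
      orbit-length = trans
        (unique-length (Unique.filter⁺ (_∈? orbit x) xs!) (orbit-unique (free (here refl)))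
          (mk⇔ (proj₂ ∘ ∈-filter⁻ (_∈? orbit x) {xs = xs})
               (λ y∈ → ∈-filter⁺ (_∈? orbit x) (orbit⊆ closed (here refl) y∈) y∈)))
        (length-applyUpTo (fold x σ) p)
      rest-closed : Closed rest
      rest-closed y∈ = let y∈xs , y∉ = ∈-filter⁻ ∉orbit? {xs = xs} y∈ in
        ∈-filter⁺ ∉orbit? (closed y∈xs) (y∉ ∘ orbit-pred)

  fixed? : Decidable (λ x → σ x ≡ x)
  fixed? x = σ x ≟ x

  -- By injectivity the moved elements are closed under `σ`; they fall into full orbits and
  -- contribute a multiple of p.
  fixed-count : (∀ {x} → P x → P (σ x)) → IsCount P r →
                ∃ λ f → IsCount (λ x → P x × σ x ≡ x) f × ∃ λ k → r ≡ f ℕ.+ k × p ℕ.∣ k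
  fixed-count P-σ count@(xs , xs! , refl , xs⇔) =
    _ , IsCount-filter fixed? count , _ , length-filter-¬ fixed? xs ,
    free⇒p∣length (Unique.filter⁺ moved? xs!) closed (proj₂ ∘ ∈-filter⁻ moved? {xs = xs})
    where
    moved? = ¬? ∘ fixed?
    closed : Closed (filter moved? xs)
    closed x∈ = let x∈xs , σx≢x = ∈-filter⁻ moved? {xs = xs} x∈ in
      ∈-filter⁺ moved? (from (xs⇔ _) (P-σ (to (xs⇔ _) x∈xs))) (σx≢x ∘ σ-injective)

-- Rotation of the leading coordinates.

rotate : ∀ n → Vec A (suc n ℕ.+ d) → Vec A (suc n ℕ.+ d)
rotate {d = d} n (x ∷ xs) = insertAt xs (fromℕ n ↑ˡ d) x

-- With the 23 leading entries exposed, all the insertions compute.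
rotate²³ : (xs : Vec A (23 ℕ.+ d)) → fold xs (rotate 22) 23 ≡ xs
rotate²³ (_ ∷ _ ∷ _ ∷ _ ∷ _ ∷ _ ∷ _ ∷ _ ∷ _ ∷ _ ∷ _ ∷ _ ∷
          _ ∷ _ ∷ _ ∷ _ ∷ _ ∷ _ ∷ _ ∷ _ ∷ _ ∷ _ ∷ _ ∷ _) = refl

-- The first entries show that `y` equals `x`; the rest of the equation then says that `x ∷ xs` is
-- fixed by the rotation that is one shorter.
rotate-fixed : ∀ n (xs : Vec A (suc n ℕ.+ d)) → rotate n xs ≡ xs →
               ∃₂ λ a rest → xs ≡ replicate (suc n) a ++ rest
rotate-fixed zero    (x ∷ xs)     eq = x , xs , refl
rotate-fixed (suc n) (x ∷ y ∷ xs) eq with Vec.∷-injective eq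
... | refl , eq′ with rotate-fixed n (x ∷ xs) eq′
... | a , rest , eq″ = a , rest , cong₂ _∷_ (Vec.∷-injectiveˡ eq″) eq″

-- `rotate` reinserts the first entry further on, so each of its invariance properties reduces to
-- one of `insertAt` at an arbitrary position, where induction applies.
dot-insertAt : ∀ (xs ys : Vec ℤ n) i {x y} →
               dot (insertAt xs i x) (insertAt ys i y) ≡ x * y + dot xs ys
dot-insertAt xs       ys       zero    = refl
dot-insertAt (x ∷ xs) (y ∷ ys) (suc i) {x′} {y′} =
  trans (cong (λ z → x * y + z) (dot-insertAt xs ys i)) (swap (x * y) (x′ * y′) _)
  where
  swap : ∀ a b c → a + (b + c) ≡ b + (a + c)
  swap = solve-∀

dot-rotate : ∀ n (xs ys : Vec ℤ (suc n ℕ.+ d)) → dot (rotate n xs) (rotate n ys) ≡ dot xs ys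
dot-rotate {d = d} n (x ∷ xs) (y ∷ ys) = dot-insertAt xs ys (fromℕ n ↑ˡ d)

vsum-insertAt : ∀ (xs : Vec ℤ n) i {x} → vsum (insertAt xs i x) ≡ x + vsum xs
vsum-insertAt xs       zero    = refl
vsum-insertAt (x ∷ xs) (suc i) {x′} = trans (cong (λ z → x + z) (vsum-insertAt xs i)) (swap x x′ _)
  where
  swap : ∀ a b c → a + (b + c) ≡ b + (a + c)
  swap = solve-∀

vsum-rotate : ∀ n (xs : Vec ℤ (suc n ℕ.+ d)) → vsum (rotate n xs) ≡ vsum xs
vsum-rotate {d = d} n (x ∷ xs) = vsum-insertAt xs (fromℕ n ↑ˡ d)

All-insertAt : ∀ {xs : Vec A n} {x} i → All P xs → P x → All P (insertAt xs i x)
All-insertAt zero    pxs        px = px ∷ pxs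
All-insertAt (suc i) (py ∷ pxs) px = py ∷ All-insertAt i pxs px

All-rotate : ∀ n {xs : Vec A (suc n ℕ.+ d)} → All P xs → All P (rotate n xs)
All-rotate {d = d} n (px ∷ pxs) = All-insertAt (fromℕ n ↑ˡ d) pxs px

zipWith-insertAt : ∀ (f : A → B → C) (xs : Vec A n) ys i {x y} →
  insertAt (zipWith f xs ys) i (f x y) ≡ zipWith f (insertAt xs i x) (insertAt ys i y)
zipWith-insertAt f xs       ys       zero    = refl
zipWith-insertAt f (x ∷ xs) (y ∷ ys) (suc i) = cong (f x y ∷_) (zipWith-insertAt f xs ys i)

zipWith-rotate : ∀ n (f : A → B → C) (xs : Vec A (suc n ℕ.+ d)) ys →
  rotate n (zipWith f xs ys) ≡ zipWith f (rotate n xs) (rotate n ys)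
zipWith-rotate {d = d} n f (x ∷ xs) (y ∷ ys) = zipWith-insertAt f xs ys (fromℕ n ↑ˡ d)

-- Phrased with `lookup` so as to unfold to the codeword congruences in `latticeA1^24` and
-- `latticeLeech`.
Related : (A → B → Set) → Vec A n → Vec B n → Set
Related R xs ys = ∀ i → R (lookup xs i) (lookup ys i)

Related-insertAt : ∀ (xs : Vec A n) (ys : Vec B n) i {x y} → Related R xs ys → R x y →
                   Related R (insertAt xs i x) (insertAt ys i y)
Related-insertAt xs       ys       zero    rs r zero    = r
Related-insertAt xs       ys       zero    rs r (suc j) = rs j
Related-insertAt (x ∷ xs) (y ∷ ys) (suc i) rs r zero    = rs zero
Related-insertAt {R = R} (x ∷ xs) (y ∷ ys) (suc i) rs r (suc j) =
  Related-insertAt {R = R} xs ys i (rs ∘ suc) r j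

Related-rotate : ∀ n (xs : Vec A (suc n ℕ.+ d)) (ys : Vec B (suc n ℕ.+ d)) → Related R xs ys →
                 Related R (rotate n xs) (rotate n ys)
Related-rotate {d = d} {R = R} n (x ∷ xs) (y ∷ ys) rs =
  Related-insertAt {R = R} xs ys (fromℕ n ↑ˡ d) (rs ∘ suc) (rs zero)

Related-unique : (∀ {x y z} → R x y → R x z → y ≡ z) → ∀ (xs : Vec A n) ys zs →
                 Related R xs ys → Related R xs zs → ys ≡ zs
Related-unique R! []       []       []       _  _  = refl
Related-unique {R = R} R! (x ∷ xs) (y ∷ ys) (z ∷ zs) rs ss =
  cong₂ _∷_ (R! {x} {y} {z} (rs zero) (ss zero)) (Related-unique {R = R} R! xs ys zs (rs ∘ suc) (ss ∘ suc))

Related-replicate : ∀ n {x y z} → R x z → R y z →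
                    Related R (replicate n x ++ y ∷ []) (replicate (n ℕ.+ 1) z)
Related-replicate zero    rx ry zero    = ry
Related-replicate (suc n) rx ry zero    = rx
Related-replicate {R = R} (suc n) rx ry (suc i) = Related-replicate {R = R} n rx ry i

-- Vectors constant on an initial block.

dot-replicate : ∀ n a b (xs ys : Vec ℤ d) →
                dot (replicate n a ++ xs) (replicate n b ++ ys) ≡ + n * (a * b) + dot xs ys
dot-replicate zero    a b xs ys = base (a * b) _
  where
  base : ∀ c d → d ≡ + 0 * c + d
  base = solve-∀
dot-replicate (suc n) a b xs ys =
  trans (cong (λ z → a * b + z) (dot-replicate n a b xs ys)) (step (+ n) (a * b) _)
  where
  step : ∀ n c d → c + (n * c + d) ≡ (+ 1 + n) * c + d
  step = solve-∀

vsum-replicate : ∀ n a (xs : Vec ℤ d) → vsum (replicate n a ++ xs) ≡ + n * a + vsum xs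
vsum-replicate zero    a xs = base a _
  where
  base : ∀ c d → d ≡ + 0 * c + d
  base = solve-∀
vsum-replicate (suc n) a xs = trans (cong (λ z → a + z) (vsum-replicate n a xs)) (step (+ n) a _)
  where
  step : ∀ n c d → c + (n * c + d) ≡ (+ 1 + n) * c + d
  step = solve-∀

-- Congruences between integers.

≡[]-intro : ∀ a b m q → a ≡ b + q * + m → a ≡[ m ] b
≡[]-intro a b m q refl = ∣⇒∣ᵤ (divides q (cancel b (q * + m)))
  where
  cancel : ∀ b c → b + c - b ≡ c
  cancel = solve-∀

≡[]-refl : ∀ a m → a ≡[ m ] a
≡[]-refl a m = ≡[]-intro a a m (+ 0) (sym (ℤ.+-identityʳ a))

-- With `≡[]-intro`, this trades divisibility for an explicit quotient, so that congruences become
-- ring identities.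
≡[]-elim : ∀ a b m → a ≡[ m ] b → ∃ λ q → a ≡ b + q * + m
≡[]-elim a b m a≡b with ∣ᵤ⇒∣ {+ m} {a - b} a≡b
... | divides q eq = q , trans (split a b) (cong (λ z → b + z) eq)
  where
  split : ∀ a b → a ≡ b + (a - b)
  split = solve-∀

≡[]-common : ∀ a b c m → a ≡[ m ] b → a ≡[ m ] c → b ≡[ m ] c
≡[]-common a b c m a≡b a≡c =
  ∣⇒∣ᵤ (subst (+ m ∣_) (diff a b c) (∣m∣n⇒∣m-n (∣ᵤ⇒∣ {+ m} {a - c} a≡c) (∣ᵤ⇒∣ {+ m} {a - b} a≡b)))
  where
  diff : ∀ a b c → (a - c) - (a - b) ≡ b - c
  diff = solve-∀

residue-unique : ∀ (f : Bool → ℤ) m → ¬ f true ≡[ m ] f false →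
                 ∀ {a b b′} → a ≡[ m ] f b → a ≡[ m ] f b′ → b ≡ b′
residue-unique f m distinct     {_} {true}  {true}  p q = refl
residue-unique f m distinct     {_} {false} {false} p q = refl
residue-unique f m distinct {a} {true}  {false} p q =
  contradiction (≡[]-common a (f true) (f false) m p q) distinct
residue-unique f m distinct {a} {false} {true}  p q =
  contradiction (≡[]-common a (f true) (f false) m q p) distinct

parity-of : ∀ y → ∃₂ λ m q → y ≡ b2z m + q * + 2
parity-of y with y ℤ.%ℕ 2 | y ℤ./ℕ 2 | ℤ.a≡a%ℕn+[a/ℕn]*n y 2 | ℤ.n%ℕd<d y 2
... | 0           | q | eq | _            = false , q , eq
... | 1           | q | eq | _            = true  , q , eq
... | suc (suc _) | _ | _  | s≤s (s≤s ())

-- The Golay code and its cyclic symmetry.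

_⊕_ : Vec Bool n → Vec Bool n → Vec Bool n
_⊕_ = zipWith _xor_

zeros : Vec Bool n
zeros = replicate _ false

xor-interchange : ∀ a b c d → (a xor b) xor (c xor d) ≡ (a xor c) xor (b xor d)
xor-interchange = CommutativeSemigroup.interchange
  (CommutativeRing.+-commutativeSemigroup Bool.xor-∧-commutativeRing)

⊕-identityˡ : (xs : Vec Bool n) → zeros ⊕ xs ≡ xs
⊕-identityˡ = Vec.zipWith-identityˡ Bool.xor-identityˡ

⊕-identityʳ : (xs : Vec Bool n) → xs ⊕ zeros ≡ xs
⊕-identityʳ = Vec.zipWith-identityʳ Bool.xor-identityʳ

⊕-self : (xs : Vec Bool n) → xs ⊕ xs ≡ zeros
⊕-self []       = refl
⊕-self (x ∷ xs) = cong₂ _∷_ (Bool.xor-same x) (⊕-self xs)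

⊕-interchange : (ws xs ys zs : Vec Bool n) → (ws ⊕ xs) ⊕ (ys ⊕ zs) ≡ (ws ⊕ ys) ⊕ (xs ⊕ zs)
⊕-interchange []       []       []       []       = refl
⊕-interchange (w ∷ ws) (x ∷ xs) (y ∷ ys) (z ∷ zs) =
  cong₂ _∷_ (xor-interchange w x y z) (⊕-interchange ws xs ys zs)

golayWord-⊕ : ∀ (as bs : Vec Bool k) rs →
              golayWord (as ⊕ bs) rs ≡ golayWord as rs ⊕ golayWord bs rs
golayWord-⊕ []       []       []       = refl
golayWord-⊕ (a ∷ as) (b ∷ bs) (r ∷ rs) = begin
  pick (a xor b) ⊕ golayWord (as ⊕ bs) rs                   ≡⟨ cong₂ _⊕_ (pick-xor a b) (golayWord-⊕ as bs rs) ⟩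
  (pick a ⊕ pick b) ⊕ (golayWord as rs ⊕ golayWord bs rs)   ≡⟨ ⊕-interchange (pick a) (pick b) _ _ ⟩
  (pick a ⊕ golayWord as rs) ⊕ (pick b ⊕ golayWord bs rs)   ∎
  where
  open ≡-Reasoning
  pick : Bool → Vec Bool 24
  pick a = if a then r else zeros
  pick-xor : ∀ a b → pick (a xor b) ≡ pick a ⊕ pick b
  pick-xor false b     = sym (⊕-identityˡ (pick b))
  pick-xor true  false = sym (⊕-identityʳ r)
  pick-xor true  true  = sym (⊕-self r)

-- An induction principle for the code: additive properties need checking only on the twelve
-- generators.
golayWord-closed : (P : Vec Bool 24 → Set) → P zeros → (∀ {x y} → P x → P y → P (x ⊕ y)) →
                   ∀ {rs : Vec (Vec Bool 24) k} → (∀ i → P (lookup rs i)) →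
                   ∀ as → P (golayWord as rs)
golayWord-closed P p0 p⊕ {[]}    prs []           = p0
golayWord-closed P p0 p⊕ {_ ∷ _} prs (true  ∷ as) =
  p⊕ (prs zero) (golayWord-closed P p0 p⊕ (prs ∘ suc) as)
-- An unselected row still contributes the zero word as a summand.
golayWord-closed P p0 p⊕ {_ ∷ _} prs (false ∷ as) =
  p⊕ p0 (golayWord-closed P p0 p⊕ (prs ∘ suc) as)

IsGolay-⊕ : ∀ {x y} → IsGolay x → IsGolay y → IsGolay (x ⊕ y)
IsGolay-⊕ (as , refl) (bs , refl) = as ⊕ bs , golayWord-⊕ as bs golayGen

_≟ᵇ_ : (xs ys : Vec Bool n) → Dec (xs ≡ ys)
_≟ᵇ_ = Vec.≡-dec Bool._≟_

-- A cyclic shift moves the row xⁱ·g to xⁱ⁻¹·g; only x⁻¹·g has to be re-expanded.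
shiftedRow : Fin 12 → Vec Bool 12
shiftedRow zero    = false ∷ true ∷ false ∷ false ∷ true ∷ false ∷ false ∷ true ∷ true ∷ true ∷ true ∷ true ∷ []
shiftedRow (suc i) = tabulate λ j → does (j Fin.≟ inject₁ i)

-- Rotation is linear, so the generators suffice, and for these the claim is decided by computation.
IsGolay-rotate : ∀ {c} → IsGolay c → IsGolay (rotate 22 c)
IsGolay-rotate (as , refl) = golayWord-closed (IsGolay ∘ rotate 22) (zeros , refl)
  (λ {x} {y} gx gy → subst IsGolay (sym (zipWith-rotate 22 _xor_ x y)) (IsGolay-⊕ gx gy))
  (λ i → shiftedRow i , shifted i) as
  where
  shifted : ∀ i → golayWord (shiftedRow i) golayGen ≡ rotate 22 (lookup golayGen i)
  shifted = from-yes (Fin.all? λ i →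
    golayWord (shiftedRow i) golayGen ≟ᵇ rotate 22 (lookup golayGen i))

-- The witness for the all-ones word is the quotient (x²³ − 1) / ((x − 1) g) over 𝔽₂.
IsGolay-constant : ∀ b → IsGolay (replicate 24 b)
IsGolay-constant false = zeros , refl
IsGolay-constant true  = true ∷ true ∷ false ∷ false ∷ false ∷ true ∷ true ∷ true ∷ false ∷ true ∷ false ∷ true ∷ [] , refl

parity : Vec Bool n → Bool
parity = Vec.foldr _ _xor_ false

parity-⊕ : (xs ys : Vec Bool n) → parity (xs ⊕ ys) ≡ parity xs xor parity ys
parity-⊕ []       []       = refl
parity-⊕ (x ∷ xs) (y ∷ ys) =
  trans (cong ((x xor y) xor_) (parity-⊕ xs ys)) (xor-interchange x y _ _)

-- The parity bit gives every generator even weight, and weight parity is additive.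
IsGolay-even : ∀ {c} → IsGolay c → parity c ≡ false
IsGolay-even (as , refl) = golayWord-closed (λ c → parity c ≡ false) refl
  (λ {x} {y} ex ey → trans (parity-⊕ x y) (cong₂ _xor_ ex ey))
  (from-yes (Fin.all? λ i → parity (lookup golayGen i) Bool.≟ false)) as

IsGolay-fixed : ∀ {c} → IsGolay c → rotate 22 c ≡ c → ∃ λ b → c ≡ replicate 24 b
IsGolay-fixed {c} golay fixed with rotate-fixed 22 c fixed
... | false , false ∷ [] , refl = false , refl
... | true  , true  ∷ [] , refl = true , refl
-- The two mixed words have weights 1 and 23, both odd.
... | false , true  ∷ [] , refl = case IsGolay-even golay of λ ()
... | true  , false ∷ [] , refl = case IsGolay-even golay of λ ()

-- The codeword c is determined by x, so a rotation fixing x fixes c as well.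
fixed-codeword : (∀ {x b b′} → R x b → R x b′ → b ≡ b′) →
                 ∀ {x : Vec A 24} {c} → rotate 22 x ≡ x → IsGolay c → Related R x c →
                 ∃ λ b → Related R x (replicate 24 b)
fixed-codeword {R = R} R! {x} {c} fixed golay rs
  with IsGolay-fixed golay (Related-unique {R = R} R! x (rotate 22 c) c
         (subst (λ y → Related R y (rotate 22 c)) fixed (Related-rotate {R = R} 22 x c rs)) rs)
... | b , refl = b , rs

-- Representations fixed by the rotation.

fold-map : ∀ (f : A → A) n (xs : Vec A k) → fold xs (Vec.map f) n ≡ Vec.map (λ x → fold x f n) xs
fold-map f zero    xs = sym (Vec.map-id xs)
fold-map f (suc n) xs =
  trans (cong (Vec.map f) (fold-map f n xs)) (sym (Vec.map-∘ f (λ x → fold x f n) xs))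

map-injective : ∀ {f : A → B} → (∀ {x y} → f x ≡ f y → x ≡ y) →
                ∀ {xs ys : Vec A n} → Vec.map f xs ≡ Vec.map f ys → xs ≡ ys
map-injective inj {[]}     {[]}     eq = refl
map-injective inj {_ ∷ _} {_ ∷ _} eq =
  cong₂ _∷_ (inj (Vec.∷-injectiveˡ eq)) (map-injective inj (Vec.∷-injectiveʳ eq))

-- All four Niemeier lattices are definitional instances, with d = 2 for δ and d = 1 for the others.
rotationLattice : (Vec ℤ (23 ℕ.+ d) → Set) → ℕ → Lattice
rotationLattice {d} M s = record { dim = 23 ℕ.+ d ; member = M ; form = dot ; scale = s }

planeLattice : (Vec ℤ 2 → Vec ℤ 2 → ℤ) → Lattice
planeLattice S = record { dim = 2 ; member = λ _ → ⊤ ; form = S ; scale = 1 }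

-- u ↦ (head u , … , head u , tail u) is an isometry from the plane onto the
-- vectors of the lattice that are fixed by the rotation of the first 23 coordinates.
record FixedPlane (M : Vec ℤ (23 ℕ.+ d) → Set) (s : ℕ) (S : Vec ℤ 2 → Vec ℤ 2 → ℤ) : Set where
  field
    head : Vec ℤ 2 → ℤ
    tail : Vec ℤ 2 → Vec ℤ d

  embed : Vec ℤ 2 → Vec ℤ (23 ℕ.+ d)
  embed u = replicate 23 (head u) ++ tail u

  field
    member-rotate : ∀ {x} → M x → M (rotate 22 x)
    embed-member  : ∀ u → M (embed u)
    -- The left side is the dot product of the embedded vectors, the constant block contributing the
    -- factor 23.
    form-embed    : ∀ u v → + 23 * (head u * head v) + dot (tail u) (tail v) ≡ + s * S u v
    -- The inverse of the embedding has rational entries; `multiple` clears the denominators.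
    multiple      : ℕ
    {{nonZero}}   : ℕ.NonZero multiple
    recover       : ℤ → Vec ℤ d → Vec ℤ 2
    recover-embed : ∀ u → recover (head u) (tail u) ≡ Vec.map (+ multiple *_) u
    -- By `rotate-fixed`, every fixed vector has this shape.
    surjective    : ∀ a w → M (replicate 23 a ++ w) → ∃ λ u → head u ≡ a × tail u ≡ w

module _ {M : Vec ℤ (23 ℕ.+ d) → Set} {s S} {{_ : ℕ.NonZero s}} (plane : FixedPlane M s S) where
  open FixedPlane plane

  private
    σ : Vec (Vec ℤ (23 ℕ.+ d)) n → Vec (Vec ℤ (23 ℕ.+ d)) n
    σ = Vec.map (rotate 22)

  σ-order : (X : Vec (Vec ℤ (23 ℕ.+ d)) n) → fold X σ 23 ≡ X
  σ-order X = trans (fold-map (rotate 22) 23 X)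
                (trans (Vec.map-cong rotate²³ X) (Vec.map-id X))

  Rep-σ : ∀ {N X} → Rep (rotationLattice M s) N X → Rep (rotationLattice M s) N (σ X)
  Rep-σ {X = X} (members , forms) = All.map⁺ (All.map member-rotate members) , λ i j →
    trans (cong₂ dot (Vec.lookup-map i (rotate 22) X) (Vec.lookup-map j (rotate 22) X))
      (trans (dot-rotate 22 (lookup X i) (lookup X j)) (forms i j))

  -- From the first entry and the tail, `recover` yields the same nonzero multiple of `u` and of
  -- `v`, and this multiple cancels.
  embed-injective : ∀ {u v} → embed u ≡ embed v → u ≡ v
  embed-injective {u} {v} eq =
    let heads , tails = Vec.++-injective (replicate 23 (head u)) (replicate 23 (head v)) eq
    in map-injective (ℤ.*-cancelˡ-≡ (+ multiple) _ _)
         (trans (sym (recover-embed u))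
           (trans (cong₂ recover (Vec.∷-injectiveˡ heads) tails) (recover-embed v)))

  -- `rotate 22 (embed u)` computes to `embed u`, so only the fusion of the two maps remains.
  σ-embed : (U : Vec (Vec ℤ 2) n) → σ (Vec.map embed U) ≡ Vec.map embed U
  σ-embed U = sym (Vec.map-∘ (rotate 22) embed U)

  embed-surjective : ∀ (X : Vec (Vec ℤ (23 ℕ.+ d)) n) → All M X → σ X ≡ X →
                     ∃ λ U → Vec.map embed U ≡ X
  embed-surjective []      []             _     = [] , refl
  embed-surjective (x ∷ X) (mx ∷ members) fixed
    with rotate-fixed 22 x (Vec.∷-injectiveˡ fixed)
       | embed-surjective X members (Vec.∷-injectiveʳ fixed)
  ... | a , w , refl | U , refl with surjective a w mx
  ... | u , refl , refl = u ∷ U , refl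

  dot-embed : ∀ (U : Vec (Vec ℤ 2) n) i j →
    dot (lookup (Vec.map embed U) i) (lookup (Vec.map embed U) j) ≡ + s * S (lookup U i) (lookup U j)
  dot-embed U i j = trans (cong₂ dot (Vec.lookup-map i embed U) (Vec.lookup-map j embed U))
    (trans (dot-replicate 23 (head u) (head v) (tail u) (tail v)) (form-embed u v))
    where
    u = lookup U i
    v = lookup U j

  -- The factor `s` in `form-embed` is the scale of the large lattice and cancels, leaving the scale
  -- 1 of the plane.
  Rep-embed : ∀ {N} U → (Rep (rotationLattice M s) N (Vec.map embed U) × σ (Vec.map embed U) ≡ Vec.map embed U)
                        ⇔ Rep (planeLattice S) N U
  Rep-embed {N} U = mk⇔
    (λ ((_ , forms) , _) → All.universal (λ _ → tt) U , λ i j →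
      trans (ℤ.*-cancelˡ-≡ (+ s) _ _ (trans (sym (dot-embed U i j)) (forms i j)))
            (sym (ℤ.*-identityˡ (N i j))))
    (λ (_ , forms) → (All.map⁺ (All.universal embed-member U) , λ i j →
      trans (dot-embed U i j)
            (cong (+ s *_) (trans (forms i j) (ℤ.*-identityˡ (N i j))))) , σ-embed U)

  -- The plane count is produced, not assumed: when two Niemeier lattices are compared, none is
  -- given.
  theta-mod-23 : ∀ {N} → IsCount (Rep (rotationLattice M s) N) r →
                 ∃ λ f → IsCount (Rep (planeLattice S) N) f × (+ f) ≡[ 23 ] (+ r)
  theta-mod-23 count
    with PrimeOrder.fixed-count (Vec.≡-dec (Vec.≡-dec ℤ._≟_)) σ 22 (from-yes (prime? 23)) σ-order
           Rep-σ count
  ... | f , fixed-count , _ , refl , ℕ.divides c refl = f ,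
    IsCount-preimage (Vec.map embed) (map-injective embed-injective) Rep-embed
      (λ X ((members , _) , fixed) → embed-surjective X members fixed) fixed-count ,
    -- Here r = f + 23c, whence the quotient -c.
    ≡[]-intro (+ f) (+ (f ℕ.+ c ℕ.* 23)) 23 (- + c) (begin
      + f                                         ≡⟨ cancel (+ f) (+ c) ⟩
      + f + + c * + 23 + - + c * + 23             ≡⟨ cong (λ z → + f + z + - + c * + 23) (ℤ.pos-* c 23) ⟨
      + (f ℕ.+ c ℕ.* 23) + - + c * + 23           ∎)
    where
    open ≡-Reasoning
    cancel : ∀ f c → f ≡ f + c * + 23 + - c * + 23
    cancel = solve-∀

theta-cong-plane : ∀ {M : Vec ℤ (23 ℕ.+ d) → Set} {s S} {{_ : ℕ.NonZero s}} → FixedPlane M s S →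
                   ThetaCong3 (rotationLattice M s) (planeLattice S) 23
theta-cong-plane plane N _ _ r r′ count count′ with theta-mod-23 plane count
... | f , plane-count , f≡r with refl ← IsCount-unique plane-count count′ =
  -- Symmetry, obtained by taking the reflexive congruence as the second one.
  ≡[]-common (+ f) (+ r) (+ f) 23 f≡r (≡[]-refl (+ f) 23)

theta-cong : ∀ {M : Vec ℤ (23 ℕ.+ d) → Set} {M′ : Vec ℤ (23 ℕ.+ k) → Set} {s s′ S}
             {{_ : ℕ.NonZero s}} {{_ : ℕ.NonZero s′}} → FixedPlane M s S → FixedPlane M′ s′ S →
             ThetaCong3 (rotationLattice M s) (rotationLattice M′ s′) 23
theta-cong plane plane′ N _ _ r r′ count count′
  with theta-mod-23 plane count | theta-mod-23 plane′ count′
... | f , plane-count , f≡r | f′ , plane-count′ , f′≡r′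
  with refl ← IsCount-unique plane-count plane-count′ =
  ≡[]-common (+ f) (+ r) (+ r′) 23 f≡r f′≡r′

-- The fixed planes of the four lattices.

All-replicate : ∀ n {x : A} → P x → All P (replicate n x)
All-replicate zero    px = []
All-replicate (suc n) px = px ∷ All-replicate n px

-- For a fixed vector (y,...,y,b) the sum condition 23y + b ≡ 0 mod 4 means b ≡ y mod 4, so b = y +
-- 4x; equal parity then follows.
D24-plane : FixedPlane (member latticeD24) 4 (form latticeS1)
D24-plane = record
  { head          = λ { (x ∷ y ∷ []) → y }
  ; tail          = λ { (x ∷ y ∷ []) → (y + + 4 * x) ∷ [] }
  ; member-rotate = λ { {v} ((m , same) , sum) →
      (m , All-rotate 22 {xs = v} same) , subst (_≡[ 4 ] + 0) (sym (vsum-rotate 22 v)) sum }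
  ; embed-member  = λ { (x ∷ y ∷ []) → let m , q , y≡ = parity-of y in
      (m , All.++⁺ {xs = replicate 23 y} (All-replicate 23 (≡[]-intro y (b2z m) 2 q y≡))
             (≡[]-intro (y + + 4 * x) (b2z m) 2 (q + + 2 * x)
               (trans (cong (λ z → z + + 4 * x) y≡) (last≡ (b2z m) q x)) ∷ [])) ,
      ≡[]-intro (vsum (replicate 23 y ++ (y + + 4 * x) ∷ [])) (+ 0) 4 (+ 6 * y + x)
        (trans (vsum-replicate 23 y ((y + + 4 * x) ∷ [])) (sum≡ x y)) }
  ; form-embed    = λ { (x ∷ y ∷ []) (x′ ∷ y′ ∷ []) → form≡ x y x′ y′ }
  ; multiple      = 4
  ; recover       = λ { a (b ∷ []) → (b - a) ∷ + 4 * a ∷ [] }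
  ; recover-embed = λ { (x ∷ y ∷ []) → cong (λ z → z ∷ + 4 * y ∷ []) (recover≡ x y) }
  ; surjective    = surj
  }
  where
  last≡ : ∀ m q x → m + q * + 2 + + 4 * x ≡ m + (q + + 2 * x) * + 2
  last≡ = solve-∀
  sum≡ : ∀ x y → + 23 * y + (y + + 4 * x + + 0) ≡ + 0 + (+ 6 * y + x) * + 4
  sum≡ = solve-∀
  form≡ : ∀ x y x′ y′ → + 23 * (y * y′) + ((y + + 4 * x) * (y′ + + 4 * x′) + + 0)
                      ≡ + 4 * (x * (+ 4 * x′ + + 1 * y′) + y * (+ 1 * x′ + + 6 * y′))
  form≡ = solve-∀
  recover≡ : ∀ x y → y + + 4 * x - y ≡ + 4 * x
  recover≡ = solve-∀
  isolate : ∀ a b → b ≡ + 23 * a + (b + + 0) - + 23 * a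
  isolate = solve-∀
  last′ : ∀ a q → + 0 + q * + 4 - + 23 * a ≡ a + + 4 * (q - + 6 * a)
  last′ = solve-∀
  surj : ∀ a w → member latticeD24 (replicate 23 a ++ w) → ∃ λ u → _ × _
  surj a (b ∷ []) (_ , sum) =
    let q , eq = ≡[]-elim (vsum (replicate 23 a ++ b ∷ [])) (+ 0) 4 sum in
    -- From 23a + b = 4q one gets b = a + 4(q - 6a).
    (q - + 6 * a) ∷ a ∷ [] , refl , cong (_∷ []) (sym (begin
      b                                 ≡⟨ isolate a b ⟩
      + 23 * a + (b + + 0) - + 23 * a   ≡⟨ cong (_- + 23 * a) (vsum-replicate 23 a (b ∷ [])) ⟨
      vsum (replicate 23 a ++ b ∷ []) - + 23 * a ≡⟨ cong (_- + 23 * a) eq ⟩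
      + 0 + q * + 4 - + 23 * a          ≡⟨ last′ a q ⟩
      a + + 4 * (q - + 6 * a)           ∎))
    where open ≡-Reasoning

-- The basis is (0,...,0,5,-5) and (1,...,1,-9,-14), of norms 50/25 = 2 and 300/25 = 12 and inner
-- product 25/25 = 1.
A24-plane : FixedPlane (member latticeA24) 25 (form latticeS2)
A24-plane = record
  { head          = λ { (x ∷ y ∷ []) → y }
  ; tail          = λ { (x ∷ y ∷ []) → (+ 5 * x - + 9 * y) ∷ (- (+ 14 * y) - + 5 * x) ∷ [] }
  ; member-rotate = λ { {v} (sum , k , same) →
      trans (vsum-rotate 22 v) sum , k , All-rotate 22 {xs = v} same }
  ; embed-member  = λ { (x ∷ y ∷ []) →
      trans (vsum-replicate 23 y ((+ 5 * x - + 9 * y) ∷ (- (+ 14 * y) - + 5 * x) ∷ [])) (sum≡ x y) , y ,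
      All.++⁺ {xs = replicate 23 y} (All-replicate 23 (≡[]-refl y 5))
        (≡[]-intro (+ 5 * x - + 9 * y) y 5 (x - + 2 * y) (second≡ x y) ∷
         ≡[]-intro (- (+ 14 * y) - + 5 * x) y 5 (- (+ 3 * y) - x) (third≡ x y) ∷ []) }
  ; form-embed    = λ { (x ∷ y ∷ []) (x′ ∷ y′ ∷ []) → form≡ x y x′ y′ }
  ; multiple      = 5
  ; recover       = λ { a (b ∷ _ ∷ []) → (b + + 9 * a) ∷ + 5 * a ∷ [] }
  ; recover-embed = λ { (x ∷ y ∷ []) → cong (λ z → z ∷ + 5 * y ∷ []) (recover≡ x y) }
  ; surjective    = surj
  }
  where
  sum≡ : ∀ x y → + 23 * y + (+ 5 * x - + 9 * y + (- (+ 14 * y) - + 5 * x + + 0)) ≡ + 0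
  sum≡ = solve-∀
  second≡ : ∀ x y → + 5 * x - + 9 * y ≡ y + (x - + 2 * y) * + 5
  second≡ = solve-∀
  third≡ : ∀ x y → - (+ 14 * y) - + 5 * x ≡ y + (- (+ 3 * y) - x) * + 5
  third≡ = solve-∀
  form≡ : ∀ x y x′ y′ →
    + 23 * (y * y′) + ((+ 5 * x - + 9 * y) * (+ 5 * x′ - + 9 * y′) +
      ((- (+ 14 * y) - + 5 * x) * (- (+ 14 * y′) - + 5 * x′) + + 0))
    ≡ + 25 * (x * (+ 2 * x′ + + 1 * y′) + y * (+ 1 * x′ + + 12 * y′))
  form≡ = solve-∀
  recover≡ : ∀ x y → + 5 * x - + 9 * y + + 9 * y ≡ + 5 * x
  recover≡ = solve-∀
  expand : ∀ k p q → + 5 * (+ 2 * (k + p * + 5) + (q - p)) - + 9 * (k + p * + 5) ≡ k + q * + 5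
  expand = solve-∀
  isolate : ∀ a b c → c ≡ + 23 * a + (b + (c + + 0)) - + 23 * a - b
  isolate = solve-∀
  last≡ : ∀ a q → + 0 - + 23 * a - (+ 5 * q - + 9 * a) ≡ - (+ 14 * a) - + 5 * q
  last≡ = solve-∀
  surj : ∀ a w → member latticeA24 (replicate 23 a ++ w) → ∃ λ u → _ × _
  surj a (b ∷ c ∷ []) (sum , k , same)
    with All.++ʳ⁻ (replicate 23 a) same
  ... | b≡k ∷ _ =
    let p , a≡ = ≡[]-elim a k 5 (All.head same)
        q , b≡ = ≡[]-elim b k 5 b≡k
        -- Solves 5x - 9a = b: since b - a = 5(q - p), we have b + 9a = 10a + 5(q - p).
        x      = + 2 * a + (q - p)
        second : + 5 * x - + 9 * a ≡ b
        second = trans (cong (λ a → + 5 * (+ 2 * a + (q - p)) - + 9 * a) a≡)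
                   (trans (expand k p q) (sym b≡))
    in x ∷ a ∷ [] , refl , cong₂ (λ b c → b ∷ c ∷ []) second (sym (begin
      c ≡⟨ isolate a b c ⟩
      + 23 * a + (b + (c + + 0)) - + 23 * a - b
        ≡⟨ cong (λ z → z - + 23 * a - b) (trans (sym (vsum-replicate 23 a (b ∷ c ∷ []))) sum) ⟩
      + 0 - + 23 * a - b                   ≡⟨ cong (λ z → + 0 - + 23 * a - z) second ⟨
      + 0 - + 23 * a - (+ 5 * x - + 9 * a) ≡⟨ last≡ a x ⟩
      - (+ 14 * a) - + 5 * x               ∎))
    where open ≡-Reasoning

-- The codeword of a fixed vector is constant, so membership means only that all coordinates have
-- equal parity, which gives (y,...,y,y+2x).
A1^24-plane : FixedPlane (member latticeA1^24) 2 (form latticeS2)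
A1^24-plane = record
  { head          = λ { (x ∷ y ∷ []) → y }
  ; tail          = λ { (x ∷ y ∷ []) → (y + + 2 * x) ∷ [] }
  ; member-rotate = λ { {v} (c , golay , rs) →
      rotate 22 c , IsGolay-rotate golay , Related-rotate {R = _≈_} 22 v c rs }
  ; embed-member  = λ { (x ∷ y ∷ []) → let m , q , y≡ = parity-of y in
      replicate 24 m , IsGolay-constant m ,
      Related-replicate {R = _≈_} 23 {y} {y + + 2 * x} {m} (≡[]-intro y (b2z m) 2 q y≡)
        (≡[]-intro (y + + 2 * x) (b2z m) 2 (q + x)
          (trans (cong (λ z → z + + 2 * x) y≡) (last≡ (b2z m) q x))) }
  ; form-embed    = λ { (x ∷ y ∷ []) (x′ ∷ y′ ∷ []) → form≡ x y x′ y′ }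
  ; multiple      = 2
  ; recover       = λ { a (b ∷ []) → (b - a) ∷ + 2 * a ∷ [] }
  ; recover-embed = λ { (x ∷ y ∷ []) → cong (λ z → z ∷ + 2 * y ∷ []) (recover≡ x y) }
  ; surjective    = surj
  }
  where
  _≈_ : ℤ → Bool → Set
  a ≈ b = a ≡[ 2 ] b2z b
  last≡ : ∀ m q x → m + q * + 2 + + 2 * x ≡ m + (q + x) * + 2
  last≡ = solve-∀
  form≡ : ∀ x y x′ y′ → + 23 * (y * y′) + ((y + + 2 * x) * (y′ + + 2 * x′) + + 0)
                      ≡ + 2 * (x * (+ 2 * x′ + + 1 * y′) + y * (+ 1 * x′ + + 12 * y′))
  form≡ = solve-∀
  recover≡ : ∀ x y → y + + 2 * x - y ≡ + 2 * x
  recover≡ = solve-∀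
  second≡ : ∀ m p q → m + p * + 2 + + 2 * (q - p) ≡ m + q * + 2
  second≡ = solve-∀
  surj : ∀ a w → member latticeA1^24 (replicate 23 a ++ w) → ∃ λ u → _ × _
  surj a (b ∷ []) (c , golay , rs) =
    let m , rs′ = fixed-codeword {R = _≈_} (λ {z} → residue-unique b2z 2 (from-no (2 ℕ.∣? 1)) {z})
                    {replicate 23 a ++ b ∷ []} {c} refl golay rs
        p , a≡ = ≡[]-elim a (b2z m) 2 (rs′ zero)
        -- Index 23 is the last coordinate, the one outside the rotated block.
        q , b≡ = ≡[]-elim b (b2z m) 2 (rs′ (fromℕ 23))
    in (q - p) ∷ a ∷ [] , refl , cong (_∷ [])
         (trans (cong (λ a → a + + 2 * (q - p)) a≡) (trans (second≡ (b2z m) p q) (sym b≡)))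

-- The basis is (1,...,1,-3) and (1,...,1,5), of norms 32/8 = 4 and 48/8 = 6 and inner product 8/8 =
-- 1.
Leech-plane : FixedPlane (member latticeLeech) 8 (form latticeS1)
Leech-plane = record
  { head          = λ { (x ∷ y ∷ []) → x + y }
  ; tail          = λ { (x ∷ y ∷ []) → (+ 5 * y - + 3 * x) ∷ [] }
  ; member-rotate = λ { {v} (m , c , golay , rs , sum) →
      m , rotate 22 c , IsGolay-rotate golay , Related-rotate {R = Residue m} 22 v c rs ,
      subst (_≡[ 8 ] (+ 4 * b2z m)) (sym (vsum-rotate 22 v)) sum }
  ; embed-member  = embed-member′
  ; form-embed    = λ { (x ∷ y ∷ []) (x′ ∷ y′ ∷ []) → form≡ x y x′ y′ }
  ; multiple      = 8
  ; recover       = λ { a (b ∷ []) → (+ 5 * a - b) ∷ (b + + 3 * a) ∷ [] }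
  ; recover-embed = λ { (x ∷ y ∷ []) →
      cong₂ (λ x y → x ∷ y ∷ []) (recover-x x y) (recover-y x y) }
  ; surjective    = surj
  }
  where
  Residue : Bool → ℤ → Bool → Set
  Residue m a b = a ≡[ 4 ] (b2z m + + 2 * b2z b)

  residue-distinct : ∀ m → ¬ (b2z m + + 2) ≡[ 4 ] (b2z m + + 0)
  residue-distinct false = from-no (4 ℕ.∣? 2)
  residue-distinct true  = from-no (4 ℕ.∣? 2)

  form≡ : ∀ x y x′ y′ → + 23 * ((x + y) * (x′ + y′)) + ((+ 5 * y - + 3 * x) * (+ 5 * y′ - + 3 * x′) + + 0)
                      ≡ + 8 * (x * (+ 4 * x′ + + 1 * y′) + y * (+ 1 * x′ + + 6 * y′))
  form≡ = solve-∀
  recover-x : ∀ x y → + 5 * (x + y) - (+ 5 * y - + 3 * x) ≡ + 8 * x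
  recover-x = solve-∀
  recover-y : ∀ x y → + 5 * y - + 3 * x + + 3 * (x + y) ≡ + 8 * y
  recover-y = solve-∀
  base-4 : ∀ m c q → m + (c + q * + 2) * + 2 ≡ m + + 2 * c + q * + 4
  base-4 = solve-∀
  last≡ : ∀ x y → + 5 * y - + 3 * x ≡ x + y + (y - x) * + 4
  last≡ = solve-∀
  last-residue : ∀ z q d → z + q * + 4 + d * + 4 ≡ z + (q + d) * + 4
  last-residue = solve-∀
  total : ∀ x y → + 23 * (x + y) + (+ 5 * y - + 3 * x + + 0) ≡ + 4 * (x + y) + (+ 2 * x + + 3 * y) * + 8
  total = solve-∀
  total-residue : ∀ m q s → + 4 * (m + q * + 2) + s * + 8 ≡ + 4 * m + (q + s) * + 8
  total-residue = solve-∀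

  embed-member′ : ∀ u → _
  embed-member′ (x ∷ y ∷ []) =
    -- The parity bit `m` and the constant codeword bit `c` are the two lowest binary digits of x +
    -- y.
    let m , q , x+y≡ = parity-of (x + y)
        c , t , q≡   = parity-of q
        mod-4 : x + y ≡ b2z m + + 2 * b2z c + t * + 4
        mod-4 = trans x+y≡ (trans (cong (λ q → b2z m + q * + 2) q≡) (base-4 (b2z m) (b2z c) t))
        b = + 5 * y - + 3 * x
    in m , replicate 24 c , IsGolay-constant c ,
       Related-replicate {R = Residue m} 23 {x + y} {b} {c}
         (≡[]-intro (x + y) (b2z m + + 2 * b2z c) 4 t mod-4)
         (≡[]-intro b (b2z m + + 2 * b2z c) 4 (t + (y - x))
           (trans (last≡ x y) (trans (cong (λ z → z + (y - x) * + 4) mod-4)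
             (last-residue (b2z m + + 2 * b2z c) t (y - x))))) ,
       ≡[]-intro (vsum (replicate 23 (x + y) ++ b ∷ [])) (+ 4 * b2z m) 8 (q + (+ 2 * x + + 3 * y))
         (trans (vsum-replicate 23 (x + y) (b ∷ []))
           (trans (total x y) (trans (cong (λ z → + 4 * z + (+ 2 * x + + 3 * y) * + 8) x+y≡)
             (total-residue (b2z m) q (+ 2 * x + + 3 * y)))))

  head≡ : ∀ m c t q → (+ 3 * m + + 7 * c + + 14 * t - q) + (q - + 2 * m - + 5 * c - + 10 * t)
                    ≡ m + + 2 * c + t * + 4
  head≡ = solve-∀
  tail≡ : ∀ m c t q → + 5 * (q - + 2 * m - + 5 * c - + 10 * t) - + 3 * (+ 3 * m + + 7 * c + + 14 * t - q)
                    ≡ + 4 * m + q * + 8 - + 23 * (m + + 2 * c + t * + 4)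
  tail≡ = solve-∀
  isolate : ∀ a b → + 23 * a + (b + + 0) - + 23 * a ≡ b
  isolate = solve-∀

  surj : ∀ a w → member latticeLeech (replicate 23 a ++ w) → ∃ λ u → _ × _
  surj a (b ∷ []) (m , c , golay , rs , sum) =
    let v = replicate 23 a ++ b ∷ []
        e , rs′ = fixed-codeword {R = Residue m}
                    (λ {z} → residue-unique (λ b → b2z m + + 2 * b2z b) 4 (residue-distinct m) {z})
                    {v} {c} refl golay rs
        t , a≡   = ≡[]-elim a (b2z m + + 2 * b2z e) 4 (rs′ zero)
        q , sum≡ = ≡[]-elim (vsum v) (+ 4 * b2z m) 8 sum
        m′ = b2z m
        e′ = b2z e
    -- Solves 8x = 5a - b and 8y = b + 3a, with a = m + 2e + 4t and b = 4m + 8q - 23a substituted;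
    -- all coefficients are then divisible by 8.
    in (+ 3 * m′ + + 7 * e′ + + 14 * t - q) ∷ (q - + 2 * m′ - + 5 * e′ - + 10 * t) ∷ [] ,
       trans (head≡ m′ e′ t q) (sym a≡) , cong (_∷ []) (begin
         + 5 * (q - + 2 * m′ - + 5 * e′ - + 10 * t) - + 3 * (+ 3 * m′ + + 7 * e′ + + 14 * t - q)
                                                        ≡⟨ tail≡ m′ e′ t q ⟩
         + 4 * m′ + q * + 8 - + 23 * (m′ + + 2 * e′ + t * + 4)
                                                        ≡⟨ cong₂ (λ s a → s - + 23 * a) sum≡ a≡ ⟨
         vsum v - + 23 * a                              ≡⟨ cong (_- + 23 * a) (vsum-replicate 23 a (b ∷ [])) ⟩
         + 23 * a + (b + + 0) - + 23 * a                ≡⟨ isolate a b ⟩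
         b                                              ∎)
    where open ≡-Reasoning

theorem7 : (ThetaCong3 latticeD24 latticeLeech 23 × ThetaCong3 latticeLeech latticeS1 23)
    × (ThetaCong3 latticeA24 latticeA1^24 23 × ThetaCong3 latticeA1^24 latticeS2 23)
theorem7 = (theta-cong D24-plane Leech-plane , theta-cong-plane Leech-plane)
         , (theta-cong A24-plane A1^24-plane , theta-cong-plane A1^24-plane)
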